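{- Let $n\ge 1$ and $m\ge 3$, and let $\lambda=(n,\dots,n)$ be the $m$-row rectangular shape ($m$ rows of length $n$). Let $M_\lambda=nT_{m-1}=n\binom{m}{2}$ be the maximum inversion number for shape $\lambda$. Then $$|S_{M_\lambda-2}(\lambda)|=\frac{(mn-2)(mn+1)}{2}.$$
   Context: A tableau of shape $\lambda$ is a bijective filling of the $m\times n$ array with $1,\dots,mn$; it is row-standard if entries increase left to right along each row. For a row-standard tableau $\tau$, a pair of entries $i<j$ in the same column is an inversion if either (1) $i$ or $j$ has no entry immediately to its right and $i$ lies below $j$, or (2) $i$ is immediately followed on its right by $i'$, $j$ is immediately followed on its right by $j'$, and $i'>j'$. $S_i(\lambda)$ is the set of row-standard tableaux of shape $\lambda$ with exactly $i$ inversions. $T_k=k(k+1)/2$ denotes the $k$-th triangular number. -}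

module Defs where

open import Data.Nat using (ℕ; suc; _+_; _*_; _∸_; _<?_)
open import Data.Fin as F using (Fin; toℕ; fromℕ<)
open import Data.Fin.Properties using () renaming (_<?_ to _<ᶠ?_)
open import Data.Vec using (Vec; lookup)
open import Data.List using (List; map; allFin)
open import Data.Nat.ListAction using (sum)
open import Data.Bool using (Bool; true; false; if_then_else_)
open import Data.Maybe using (Maybe; just; nothing)
open import Data.Product using (_×_; Σ; ∃; ∃-syntax)
open import Relation.Nullary.Decidable using (⌊_⌋; yes; no)
open import Relation.Binary.PropositionalEquality using (_≡_)

-- A filling of the m × n array (m rows of length n).  Entries 1..mn are
-- represented by Fin (m * n), i.e. by 0..mn-1 (an order-preserving shift).
-- Row index 0 is the top row; a larger row index means lower.
Tableau : ℕ → ℕ → Set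
Tableau m n = Vec (Vec (Fin (m * n)) n) m

entry : ∀ {m n} → Tableau m n → Fin m → Fin n → Fin (m * n)
entry t r c = lookup (lookup t r) c

Bijective : ∀ {m n} → Tableau m n → Set
Bijective {m} {n} t =
  (∀ (k : Fin (m * n)) → ∃[ r ] ∃[ c ] entry t r c ≡ k) ×
  (∀ r c r' c' → entry t r c ≡ entry t r' c' → (r ≡ r') × (c ≡ c'))

RowStandard : ∀ {m n} → Tableau m n → Set
RowStandard t = Bijective t × (∀ r c c' → c F.< c' → entry t r c F.< entry t r c')

nextCol : ∀ {n} → Fin n → Maybe (Fin n)
nextCol {n} c with suc (toℕ c) <? n
... | yes p = just (fromℕ< p)
... | no _  = nothing

isInversion : ∀ {m n} → Tableau m n → Fin n → Fin m → Fin m → Bool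
isInversion t c r r' with entry t r c <ᶠ? entry t r' c
... | no _ = false
... | yes _ with nextCol c
...   | nothing = ⌊ r' <ᶠ? r ⌋
...   | just c' = ⌊ entry t r' c' <ᶠ? entry t r c' ⌋

inversions : ∀ {m n} → Tableau m n → ℕ
inversions {m} {n} t =
  sum (map (λ c → sum (map (λ r → sum (map (λ r' →
    if isInversion t c r r' then 1 else 0) (allFin m))) (allFin m))) (allFin n))

T : ℕ → ℕ
T k = (k * suc k) Data.Nat./ 2

{-# OPTIONS --safe #-}

-- Insert the entries of a row-standard tableau in decreasing order, so that every row grows
-- from right to left.  At each moment order the rows by "shorter filled part first, then
-- smaller leftmost entry first".  The number of rows preceding the row that receives the next
-- entry v is exactly the number of non-inverted pairs in the column of v with larger element v.
-- Thus a tableau is determined by its word w(0), …, w(mn-1) of ranks, Σ w = nT(m-1) − inversions,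
-- and w(v) ≤ v.  Conversely every word with w(v) ≤ v and Σ w < m is realised, because the
-- insertion never lacks a non-full row of the prescribed rank.  With Σ w = 2 < m there remain
-- the words 0 0 w' with Σ w' = 2 and 0 1 w' with Σ w' = 1.
module Submission where

open import Defs
open import Data.Nat renaming (_≟_ to _≟ℕ_)
open import Data.Nat.Properties hiding (_≟_)
open import Data.Nat.DivMod using (m*n/n≡m; /-monoˡ-≤)
open import Data.Nat.Solver using (module +-*-Solver)
open import Data.Bool using (if_then_else_)
open import Data.Fin as F using (Fin; toℕ; fromℕ<; punchOut)
open import Data.Fin.Properties
  using (_≟_; toℕ-injective; toℕ<n; toℕ-fromℕ<; fromℕ<-toℕ; any?; punchOut-injective; injective⇒≤)
  renaming (_<?_ to _<ᶠ?_)
open import Data.Vec using (Vec; []; _∷_; lookup; tabulate)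
open import Data.Vec.Properties using (lookup∘tabulate; tabulate∘lookup; tabulate-cong; ∷-injectiveʳ)
open import Data.List using (List; length; [_]; _++_) renaming ([] to []ᴸ; _∷_ to _∷ᴸ_)
import Data.List as List
import Data.List.Properties as List
import Data.Nat.ListAction as ListAction
open import Data.List.Relation.Unary.Any using (here; there)
open import Data.List.Relation.Unary.All using ([])
open import Data.List.Relation.Unary.Unique.Propositional using (Unique; []; _∷_)
import Data.List.Relation.Unary.Unique.Propositional.Properties as Unique
open import Data.List.Membership.Propositional using (_∈_)
open import Data.List.Membership.Propositional.Properties using (∈-map⁺; ∈-map⁻; ∈-++⁺ˡ; ∈-++⁺ʳ; ∈-++⁻)
open import Data.Product using (Σ; ∃; ∃-syntax; _×_; _,_; proj₁; proj₂; map)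
open import Data.Sum using (_⊎_; inj₁; inj₂)
open import Function using (_∘_; Injective)
open import Function.Bundles using (_⇔_; mk⇔; Equivalence)
open import Relation.Nullary using (¬_; Dec; yes; no; does; contradiction)
open import Relation.Nullary.Decidable using (_×-dec_; _⊎-dec_; dec-true; dec-false; ⌊_⌋)
open import Relation.Binary.Definitions using (Irreflexive; Transitive; Decidable; tri<; tri≈; tri>)
open import Relation.Binary.PropositionalEquality hiding ([_])
open import Algebra.Properties.CommutativeMonoid.Sum +-0-commutativeMonoid
  using (sum; sum-cong-≗; ∑-distrib-+; ∑-comm)

-- Indicators and finite sums.

𝟙 : {A : Set} → Dec A → ℕ
𝟙 a? = if does a? then 1 else 0

𝟙-yes : {A : Set} (a? : Dec A) → A → 𝟙 a? ≡ 1
𝟙-yes (yes _) _ = refl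
𝟙-yes (no ¬a) a = contradiction a ¬a

𝟙-no : {A : Set} (a? : Dec A) → ¬ A → 𝟙 a? ≡ 0
𝟙-no (yes a) ¬a = contradiction a ¬a
𝟙-no (no _) _ = refl

𝟙-mono : {A B : Set} (a? : Dec A) (b? : Dec B) → (A → B) → 𝟙 a? ≤ 𝟙 b?
𝟙-mono (yes a) b? f = ≤-reflexive (sym (𝟙-yes b? (f a)))
𝟙-mono (no _)  b? f = z≤n

𝟙-cong : {A B : Set} (a? : Dec A) (b? : Dec B) → (A → B) → (B → A) → 𝟙 a? ≡ 𝟙 b?
𝟙-cong a? b? f g = ≤-antisym (𝟙-mono a? b? f) (𝟙-mono b? a? g)

sum-const : ∀ n a → sum {n} (λ _ → a) ≡ n * a
sum-const zero    a = refl
sum-const (suc n) a = cong (a +_) (sum-const n a)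

sum-one : ∀ n → sum {n} (λ _ → 1) ≡ n
sum-one n = trans (sum-const n 1) (*-identityʳ n)

sum-zero : ∀ n → sum {n} (λ _ → 0) ≡ 0
sum-zero n = trans (sum-const n 0) (*-zeroʳ n)

sum-mono-≤ : ∀ {n} {f g : Fin n → ℕ} → (∀ i → f i ≤ g i) → sum f ≤ sum g
sum-mono-≤ {zero}  _ = z≤n
sum-mono-≤ {suc n} p = +-mono-≤ (p F.zero) (sum-mono-≤ (p ∘ F.suc))

sum-mono-< : ∀ {n} {f g : Fin n → ℕ} → (∀ i → f i ≤ g i) → (∃ λ i → f i < g i) → sum f < sum g
sum-mono-< p (F.zero  , q) = +-mono-<-≤ q (sum-mono-≤ (p ∘ F.suc))
sum-mono-< p (F.suc i , q) = +-mono-≤-< (p F.zero) (sum-mono-< (p ∘ F.suc) (i , q))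

≤sum : ∀ {n} (f : Fin n → ℕ) i → f i ≤ sum f
≤sum f F.zero    = m≤m+n _ _
≤sum f (F.suc i) = ≤-trans (≤sum (f ∘ F.suc) i) (m≤n+m _ _)

sum-single : ∀ {n} (f : Fin n → ℕ) i → (∀ j → j ≢ i → f j ≡ 0) → sum f ≡ f i
sum-single {suc n} f F.zero p =
  trans (cong (f F.zero +_) (trans (sum-cong-≗ (λ j → p (F.suc j) λ ())) (sum-zero n))) (+-identityʳ _)
sum-single {suc n} f (F.suc i) p =
  trans (cong (_+ sum (f ∘ F.suc)) (p F.zero λ ()))
        (sum-single (f ∘ F.suc) i λ j j≢i → p (F.suc j) λ { refl → j≢i refl })

sum-𝟙-≟ : ∀ {n} (i : Fin n) → sum (λ j → 𝟙 (j ≟ i)) ≡ 1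
sum-𝟙-≟ i = trans (sum-single _ i (λ j j≢i → 𝟙-no (j ≟ i) j≢i)) (𝟙-yes (i ≟ i) refl)

-- Pigeonhole: if `k` were missed, `punchOut` would turn `f` into an injection of `suc n` elements
-- into `n`.
injective⇒surjective : ∀ {n} {f : Fin n → Fin n} → Injective _≡_ _≡_ f → ∀ k → ∃ λ i → f i ≡ k
injective⇒surjective {suc n} {f} inj k with any? (λ i → f i ≟ k)
... | yes p = p
... | no ¬p = contradiction (injective⇒≤ g-injective) 1+n≰n
  where
  k≢f : ∀ i → k ≢ f i
  k≢f i eq = ¬p (i , sym eq)
  g-injective : Injective _≡_ _≡_ (λ i → punchOut (k≢f i))
  g-injective {i} {j} eq = inj (punchOut-injective (k≢f i) (k≢f j) eq)

-- Ranks in a finite strict total order.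

module Rank {m : ℕ} {_≺_ : Fin m → Fin m → Set} (_≺?_ : Decidable _≺_)
  (≺-irrefl : Irreflexive _≡_ _≺_) (≺-trans : Transitive _≺_)
  (≺-connex : ∀ {i j} → i ≢ j → i ≺ j ⊎ j ≺ i) where

  rank : Fin m → ℕ
  rank i = sum (λ j → 𝟙 (j ≺? i))

  -- By transitivity every predecessor of `i` precedes `j`; `i` itself supplies strictness.
  rank-mono : ∀ {i j} → i ≺ j → rank i < rank j
  rank-mono {i} {j} i≺j = sum-mono-<
    (λ l → 𝟙-mono (l ≺? i) (l ≺? j) (λ l≺i → ≺-trans l≺i i≺j))
    (i , subst₂ _<_ (sym (𝟙-no (i ≺? i) (≺-irrefl refl))) (sym (𝟙-yes (i ≺? j) i≺j)) z<s)

  rank-injective : ∀ {i j} → rank i ≡ rank j → i ≡ j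
  rank-injective {i} {j} eq with i ≟ j
  ... | yes i≡j = i≡j
  ... | no i≢j with ≺-connex i≢j
  ...   | inj₁ i≺j = contradiction (rank-mono i≺j) (<-irrefl eq)
  ...   | inj₂ j≺i = contradiction (rank-mono j≺i) (<-irrefl (sym eq))

  rank<m : ∀ i → rank i < m
  rank<m i = subst (rank i <_) (sum-one m) (sum-mono-<
    (λ j → 𝟙-mono (j ≺? i) (yes j) (λ _ → j))
    (i , subst (_< 1) (sym (𝟙-no (i ≺? i) (≺-irrefl refl))) z<s))

  rank-surjective : ∀ {k} → k < m → ∃ λ i → rank i ≡ k
  rank-surjective k<m =
    let i , eq = injective⇒surjective rankᶠ-injective (fromℕ< k<m)
    in i , trans (sym (toℕ-fromℕ< (rank<m i))) (trans (cong toℕ eq) (toℕ-fromℕ< k<m))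
    where
    rankᶠ-injective : Injective _≡_ _≡_ (λ i → fromℕ< (rank<m i))
    rankᶠ-injective {i} {j} eq = rank-injective
      (trans (sym (toℕ-fromℕ< (rank<m i))) (trans (cong toℕ eq) (toℕ-fromℕ< (rank<m j))))

-- Counting with an injective labelling.

module _ {m : ℕ} {g : Fin m → ℕ} (g-injective : Injective _≡_ _≡_ g) where

  -- Induction on `b`: passing to `suc b` adds only indices labelled `b`, and injectivity allows at
  -- most one (`hits`).
  count-below : ∀ b → sum (λ i → 𝟙 (g i <? b)) ≤ b
  count-below zero = ≤-reflexive (sum-zero m)
  count-below (suc b) = begin
    sum (λ i → 𝟙 (g i <? suc b))                              ≤⟨ sum-mono-≤ split ⟩
    sum (λ i → 𝟙 (g i <? b) + 𝟙 (g i ≟ℕ b))                   ≡⟨ ∑-distrib-+ (λ i → 𝟙 (g i <? b)) _ ⟩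
    sum (λ i → 𝟙 (g i <? b)) + sum (λ i → 𝟙 (g i ≟ℕ b))       ≤⟨ +-mono-≤ (count-below b) hits ⟩
    b + 1                                                     ≡⟨ +-comm b 1 ⟩
    suc b                                                     ∎
    where
    open ≤-Reasoning
    split : ∀ i → 𝟙 (g i <? suc b) ≤ 𝟙 (g i <? b) + 𝟙 (g i ≟ℕ b)
    split i with <-cmp (g i) b
    ... | tri< p _ _ = ≤-trans (𝟙-mono (g i <? suc b) (g i <? b) (λ _ → p)) (m≤m+n _ _)
    ... | tri≈ _ p _ = ≤-trans (𝟙-mono (g i <? suc b) (g i ≟ℕ b) (λ _ → p)) (m≤n+m _ _)
    ... | tri> _ _ p = ≤-trans (≤-reflexive (𝟙-no (g i <? suc b) (≤⇒≯ p))) z≤n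
    hits : sum (λ i → 𝟙 (g i ≟ℕ b)) ≤ 1
    hits with any? (λ i → g i ≟ℕ b)
    ... | yes (i , refl) = ≤-reflexive (trans
            (sum-cong-≗ (λ j → 𝟙-cong (g j ≟ℕ g i) (j ≟ i) g-injective (cong g)))
            (sum-𝟙-≟ i))
    ... | no ¬p = ≤-trans (≤-reflexive (trans
            (sum-cong-≗ (λ j → 𝟙-no (g j ≟ℕ b) (λ eq → ¬p (j , eq))))
            (sum-zero m))) z≤n

  -- Each of the `m * m` ordered pairs satisfies exactly one of `g i < g j`, `g j < g i`, `j ≡ i`.
  -- Exchanging the summations shows that the first two classes both have size `X`, so
  -- `X + X + m ≡ m * m`; the doubled form disposes of the division in `T`.
  count-pairs : sum (λ i → sum (λ j → 𝟙 (g i <? g j))) ≡ T (m ∸ 1)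
  count-pairs = sym (trans (cong (_/ 2) (trans (numerator m) (sym twice))) (m*n/n≡m X 2))
    where
    open ≡-Reasoning
    X = sum (λ i → sum (λ j → 𝟙 (g i <? g j)))
    trichotomy : ∀ i j → 𝟙 (g i <? g j) + 𝟙 (g j <? g i) + 𝟙 (j ≟ i) ≡ 1
    trichotomy i j with <-cmp (g i) (g j)
    ... | tri< p q r rewrite 𝟙-yes (g i <? g j) p | 𝟙-no (g j <? g i) r | 𝟙-no (j ≟ i) (λ e → q (cong g (sym e))) = refl
    ... | tri≈ p q r rewrite 𝟙-no (g i <? g j) p | 𝟙-no (g j <? g i) r | 𝟙-yes (j ≟ i) (g-injective (sym q)) = refl
    ... | tri> p q r rewrite 𝟙-no (g i <? g j) p | 𝟙-yes (g j <? g i) r | 𝟙-no (j ≟ i) (λ e → q (cong g (sym e))) = refl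
    square : X + X + m ≡ m * m
    square = begin
      X + X + m
        ≡⟨ cong₂ _+_ (cong (X +_) (∑-comm (λ i j → 𝟙 (g i <? g j))))
                     (sym (trans (sum-cong-≗ {m} sum-𝟙-≟) (sum-one m))) ⟩
      X + sum {m} (λ i → sum {m} (λ j → 𝟙 (g j <? g i))) + sum {m} (λ i → sum {m} (λ j → 𝟙 (j ≟ i)))
        ≡⟨ cong (_+ sum {m} (λ i → sum {m} (λ j → 𝟙 (j ≟ i)))) (sym (∑-distrib-+ (λ i → sum {m} (λ j → 𝟙 (g i <? g j))) _)) ⟩
      sum {m} (λ i → sum {m} (λ j → 𝟙 (g i <? g j)) + sum {m} (λ j → 𝟙 (g j <? g i))) + sum {m} (λ i → sum {m} (λ j → 𝟙 (j ≟ i)))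
        ≡⟨ sym (∑-distrib-+ (λ i → sum {m} (λ j → 𝟙 (g i <? g j)) + sum {m} (λ j → 𝟙 (g j <? g i))) _) ⟩
      sum {m} (λ i → sum {m} (λ j → 𝟙 (g i <? g j)) + sum {m} (λ j → 𝟙 (g j <? g i)) + sum {m} (λ j → 𝟙 (j ≟ i)))
        ≡⟨ sum-cong-≗ {m} (λ i → trans (cong (_+ sum {m} (λ j → 𝟙 (j ≟ i))) (sym (∑-distrib-+ (λ j → 𝟙 (g i <? g j)) _)))
                                   (sym (∑-distrib-+ (λ j → 𝟙 (g i <? g j) + 𝟙 (g j <? g i)) _))) ⟩
      sum {m} (λ i → sum {m} (λ j → 𝟙 (g i <? g j) + 𝟙 (g j <? g i) + 𝟙 (j ≟ i)))
        ≡⟨ sum-cong-≗ {m} (λ i → trans (sum-cong-≗ {m} (trichotomy i)) (sum-one m)) ⟩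
      sum {m} (λ i → m)
        ≡⟨ sum-const m m ⟩
      m * m ∎
    numerator : ∀ m → (m ∸ 1) * suc (m ∸ 1) ≡ m * m ∸ m
    numerator zero    = refl
    numerator (suc m) = trans (*-comm m (suc m)) (sym (trans (cong (_∸ suc m) (*-suc (suc m) m)) (m+n∸m≡n (suc m) (suc m * m))))
    twice : X * 2 ≡ m * m ∸ m
    twice = sym (trans (cong (_∸ m) (sym square)) (trans (m+n∸n≡m (X + X) m)
      (sym (trans (*-comm X 2) (cong (X +_) (+-identityʳ X))))))

-- Partially filled arrays.

module Growth (m n : ℕ) where

  Array : Set
  Array = Fin m → ℕ → ℕ

  -- Counts the non-inverted pairs of column c whose larger element is e r c.
  cost : Array → Fin m → ℕ → ℕ
  cost e r c = sum (λ r' → 𝟙 ((e r' c <? e r c) ×-dec (e r' (suc c) <? e r (suc c))))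

  infix 4 _≈[_]_
  -- Only entries above `x` are compared. A blank is 0 and counts as small, so a stage can be
  -- compared with a completion whose smaller entries are still to be placed.
  _≈[_]_ : Array → ℕ → Array → Set
  e ≈[ x ] e' = ∀ r c → e r c ≡ e' r c ⊎ (e r c ≤ x × e' r c ≤ x)

  ≈-above : ∀ {e x e' r c} → e ≈[ x ] e' → x < e r c → e r c ≡ e' r c
  ≈-above {r = r} {c} e≈e' x<e with e≈e' r c
  ... | inj₁ eq = eq
  ... | inj₂ (e≤x , _) = contradiction x<e (≤⇒≯ e≤x)

  ≈-below : ∀ {e x e' r c} → e ≈[ x ] e' → e r c ≤ x → e' r c ≤ x
  ≈-below {r = r} {c} e≈e' e≤x with e≈e' r c
  ... | inj₁ eq = subst (_≤ _) eq e≤x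
  ... | inj₂ (_ , e'≤x) = e'≤x

  ≈-trans : ∀ {e x e' e''} → e ≈[ suc x ] e' → e' ≈[ x ] e'' → e ≈[ suc x ] e''
  ≈-trans p q r c with p r c | q r c
  ... | inj₁ a | inj₁ b = inj₁ (trans a b)
  ... | inj₁ a | inj₂ (b , d) = inj₂ (subst (_≤ _) (sym a) (m≤n⇒m≤1+n b) , m≤n⇒m≤1+n d)
  ... | inj₂ (a , b) | inj₁ d = inj₂ (a , subst (_≤ _) d b)
  ... | inj₂ (a , _) | inj₂ (_ , d) = inj₂ (a , m≤n⇒m≤1+n d)

  -- An array holding those of the entries 1, …, mn that exceed x; 0 marks a blank cell.
  -- The fictitious column n contains mn + 1 + r in row r, so that "lies below" in the last
  -- column becomes the same comparison of right neighbours as in the other columns.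
  record Stage (x : ℕ) : Set where
    field
      val      : Array
      front    : Fin m → ℕ
      front≤n  : ∀ r → front r ≤ n
      blank    : ∀ {r c} → c < front r → val r c ≡ 0
      filled   : ∀ {r c} → front r ≤ c → x < val r c
      sentinel : ∀ {r c} → n ≤ c → val r c ≡ suc (m * n + toℕ r)
      bounded  : ∀ {r c} → c < n → val r c ≤ m * n
      mono     : ∀ {r c} → front r ≤ c → c < n → val r c < val r (suc c)
      inj      : ∀ {r c r' c'} → c < n → c' < n → x < val r c → val r c ≡ val r' c' → r ≡ r' × c ≡ c'
      surj     : ∀ {v} → x < v → v ≤ m * n → ∃ λ r → ∃ λ c → c < n × val r c ≡ v
      total    : sum front ≡ x

    x≤mn : x ≤ m * n
    x≤mn = subst₂ _≤_ total (sum-const m n) (sum-mono-≤ front≤n)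

    blank-or-filled : ∀ r c → (c < front r × val r c ≡ 0) ⊎ (front r ≤ c × x < val r c)
    blank-or-filled r c with c <? front r
    ... | yes p = inj₁ (p , blank p)
    ... | no ¬p = inj₂ (≮⇒≥ ¬p , filled (≮⇒≥ ¬p))

    infix 4 _≺_ _≺?_
    -- `front r` counts the blanks of row `r`, so a larger `front` means a shorter filled part. The
    -- leftmost entry of an empty row is its sentinel.
    _≺_ : Fin m → Fin m → Set
    r' ≺ r = front r < front r' ⊎ (front r ≡ front r' × val r' (front r') < val r (front r))

    _≺?_ : Decidable _≺_
    r' ≺? r = (front r <? front r') ⊎-dec ((front r ≟ℕ front r') ×-dec (val r' (front r') <? val r (front r)))

    ≺-irrefl : Irreflexive _≡_ _≺_
    ≺-irrefl refl (inj₁ p) = <-irrefl refl p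
    ≺-irrefl refl (inj₂ (_ , p)) = <-irrefl refl p

    ≺-trans : Transitive _≺_
    ≺-trans (inj₁ p) (inj₁ q) = inj₁ (<-trans q p)
    ≺-trans (inj₁ p) (inj₂ (e , _)) = inj₁ (≤-<-trans (≤-reflexive e) p)
    ≺-trans (inj₂ (e , _)) (inj₁ q) = inj₁ (<-≤-trans q (≤-reflexive e))
    ≺-trans (inj₂ (e , p)) (inj₂ (d , q)) = inj₂ (trans d e , <-trans p q)

    -- In non-empty rows the leftmost entries are genuine and `inj` applies; in empty rows the
    -- sentinels reveal the row index.
    head-injective : ∀ {r r'} → front r ≡ front r' → val r (front r) ≡ val r' (front r') → r ≡ r'
    head-injective {r} {r'} fe ve with front r <? n
    ... | yes p = proj₁ (inj p (subst (_< n) fe p) (filled ≤-refl) ve)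
    ... | no ¬p = toℕ-injective (+-cancelˡ-≡ (m * n) _ _ (suc-injective
            (trans (sym (sentinel (≮⇒≥ ¬p))) (trans ve (sentinel (subst (n ≤_) fe (≮⇒≥ ¬p)))))))

    ≺-connex : ∀ {r r'} → r ≢ r' → r ≺ r' ⊎ r' ≺ r
    ≺-connex {r} {r'} r≢r' with <-cmp (front r) (front r')
    ... | tri< p _ _ = inj₂ (inj₁ p)
    ... | tri> _ _ p = inj₁ (inj₁ p)
    ... | tri≈ _ e _ with <-cmp (val r (front r)) (val r' (front r'))
    ...   | tri< p _ _ = inj₁ (inj₂ (sym e , p))
    ...   | tri> _ _ p = inj₂ (inj₂ (e , p))
    ...   | tri≈ _ d _ = contradiction (head-injective e d) r≢r'

    open Rank _≺?_ ≺-irrefl ≺-trans ≺-connex public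

    active : ℕ
    active = sum (λ r → 𝟙 (0 <? front r))

    active≤m : active ≤ m
    active≤m = subst (active ≤_) (sum-one m) (sum-mono-≤ (λ r → 𝟙-mono (0 <? front r) (yes r) (λ _ → r)))

    -- Every row with a blank precedes a full one. Hence ranks below `active` belong to rows that
    -- can still receive an entry, which is what `pick` uses.
    front≡0⇒active≤rank : ∀ {r} → front r ≡ 0 → active ≤ rank r
    front≡0⇒active≤rank {r} e = sum-mono-≤ λ r' →
      𝟙-mono (0 <? front r') (r' ≺? r) (λ p → inj₁ (subst (_< front r') (sym e) p))

    pick : ∀ {k} → k < active → ∃ λ r → ∃ λ c → front r ≡ suc c × rank r ≡ k
    pick {k} k<a =
      let r , eq = rank-surjective (<-≤-trans k<a active≤m)
          nonzero = ≢-nonZero λ e → ≤⇒≯ (subst (active ≤_) eq (front≡0⇒active≤rank e)) k<a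
      in r , pred (front r) , sym (suc-pred (front r) ⦃ nonzero ⦄) , eq

  open Stage

  front≡0 : (t : Stage 0) → ∀ r → front t r ≡ 0
  front≡0 t r = n≤0⇒n≡0 (subst (front t r ≤_) (total t) (≤sum (front t) r))

  -- The cost of an entry is the rank of its row at insertion.

  module _ {x : ℕ} (s : Stage (suc x)) (t : Stage 0) (s≈t : val s ≈[ suc x ] val t)
           {r : Fin m} {c : ℕ} (c<n : c < n) (new : val t r c ≡ suc x) where

    blank-below : ∀ {r' c'} → val t r' c' ≤ suc x → c' < front s r'
    blank-below {r'} {c'} v≤ with blank-or-filled s r' c'
    ... | inj₁ (p , _) = p
    ... | inj₂ (_ , p) = contradiction p (≤⇒≯ (subst (_≤ suc x) (sym (≈-above s≈t p)) v≤))

    below-blank : ∀ {r' c'} → c' < front s r' → val t r' c' ≤ suc x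
    below-blank p = ≈-below s≈t (subst (_≤ suc x) (sym (blank s p)) z≤n)

    right-above : suc x < val t r (suc c)
    right-above = subst (_< val t r (suc c)) new (mono t (subst (_≤ c) (sym (front≡0 t r)) z≤n) c<n)

    -- The right neighbour of `suc x` in `t` exceeds `suc x` (in the last column it is the
    -- sentinel), so it is already present, while the cell itself is blank: the blanks of row `r`
    -- end at column `c`.
    front-new : front s r ≡ suc c
    front-new = ≤-antisym
      (≮⇒≥ λ p → contradiction right-above (≤⇒≯ (below-blank p)))
      (blank-below {r} {c} (≤-reflexive new))

    head-value : ∀ {r'} → suc c ≡ front s r' → val s r' (front s r') ≡ val t r' (suc c)
    head-value {r'} eq = trans (≈-above s≈t (filled s ≤-refl)) (cong (val t r') (sym eq))

    -- The indicators agree row by row. The entry of `r'` in column `c` of `t` is below `suc x`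
    -- exactly when that cell is still blank and `r'` is not `r`. If the next cell of `r'` is blank
    -- too, its final entry is below the right neighbour of `suc x`, and `r'` has the larger
    -- `front`. Otherwise the fronts tie and the leftmost entries are the two right neighbours.
    cost≡rank : cost (val t) r c ≡ rank s r
    cost≡rank = sum-cong-≗ λ r' →
      𝟙-cong ((val t r' c <? val t r c) ×-dec (val t r' (suc c) <? val t r (suc c))) (_≺?_ s r' r) (to r') (from r')
      where
      to : ∀ r' → val t r' c < val t r c × val t r' (suc c) < val t r (suc c) → _≺_ s r' r
      to r' (p , q) with m≤n⇒m<n∨m≡n (blank-below {r'} (<⇒≤ (subst (val t r' c <_) new p)))
      ... | inj₁ l = inj₁ (subst (_< front s r') (sym front-new) l)
      ... | inj₂ e = inj₂ (trans front-new e ,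
              subst₂ _<_ (sym (head-value e)) (sym (head-value (sym front-new))) q)
      from : ∀ r' → _≺_ s r' r → val t r' c < val t r c × val t r' (suc c) < val t r (suc c)
      from r' r'≺r = subst (val t r' c <_) (sym new) (≤∧≢⇒< (below-blank (left r'≺r)) not-new) , right r'≺r
        where
        left : _≺_ s r' r → c < front s r'
        left (inj₁ l) = <⇒≤ (subst (_< front s r') front-new l)
        left (inj₂ (e , _)) = ≤-reflexive (trans (sym front-new) e)
        -- Within column `c` the value `suc x` occurs only in row `r`, and no row precedes itself.
        not-new : val t r' c ≢ suc x
        not-new e = ≺-irrefl s (proj₁ (inj t c<n c<n (subst (0 <_) (sym e) z<s) (trans e (sym new)))) r'≺r
        right : _≺_ s r' r → val t r' (suc c) < val t r (suc c)
        right (inj₁ l) = ≤-<-trans (below-blank (subst (_< front s r') front-new l)) right-above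
        right (inj₂ (e , l)) = subst₂ _<_ (head-value (trans (sym front-new) e)) (head-value (sym front-new)) l

  -- Inserting one entry.

  module Push {x : ℕ} (s : Stage (suc x)) (r : Fin m) (c : ℕ) (fr : front s r ≡ suc c) where

    val′ : Array
    val′ r' c' = if does ((r' ≟ r) ×-dec (c' ≟ℕ c)) then suc x else val s r' c'

    front′ : Fin m → ℕ
    front′ r' = if does (r' ≟ r) then c else front s r'

    c<n : c < n
    c<n = subst (_≤ n) fr (front≤n s r)

    was-blank : val s r c ≡ 0
    was-blank = blank s (≤-reflexive (sym fr))

    -- Each case carries the resulting value of `val′`, so that later case splits need not unfold
    -- the conditional.
    data Cell (r' : Fin m) (c' : ℕ) : Set where
      new : r' ≡ r → c' ≡ c → val′ r' c' ≡ suc x → Cell r' c'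
      old : ¬ (r' ≡ r × c' ≡ c) → val′ r' c' ≡ val s r' c' → Cell r' c'

    cell : ∀ r' c' → Cell r' c'
    cell r' c' with (r' ≟ r) ×-dec (c' ≟ℕ c) in eq
    ... | yes (p , q) = new p q (cong (λ d → if does d then suc x else val s r' c') eq)
    ... | no ¬p = old ¬p (cong (λ d → if does d then suc x else val s r' c') eq)

    val′-old : ∀ {r' c'} → ¬ (r' ≡ r × c' ≡ c) → val′ r' c' ≡ val s r' c'
    val′-old {r'} {c'} ¬p with cell r' c'
    ... | new p q _ = contradiction (p , q) ¬p
    ... | old _ e = e

    data Row (r' : Fin m) : Set where
      new : r' ≡ r → front′ r' ≡ c → Row r'
      old : r' ≢ r → front′ r' ≡ front s r' → Row r'

    row : ∀ r' → Row r'
    row r' with r' ≟ r in eq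
    ... | yes p = new p (cong (λ d → if does d then c else front s r') eq)
    ... | no ¬p = old ¬p (cong (λ d → if does d then c else front s r') eq)

    front-split : ∀ r' → front s r' ≡ front′ r' + 𝟙 (r' ≟ r)
    front-split r' with row r'
    ... | new refl e = trans fr (trans (sym (+-comm c 1)) (sym (cong₂ _+_ e (𝟙-yes (r ≟ r) refl))))
    ... | old ne e = sym (trans (cong₂ _+_ e (𝟙-no (r' ≟ r) ne)) (+-identityʳ _))

    front′≤ : ∀ r' → front′ r' ≤ front s r'
    front′≤ r' = subst (front′ r' ≤_) (sym (front-split r')) (m≤m+n _ _)

    filled′ : ∀ {r' c'} → front′ r' ≤ c' → x < val′ r' c'
    filled′ {r'} {c'} p with cell r' c'
    ... | new _ _ e = ≤-reflexive (sym e)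
    ... | old ¬q e with row r'
    ...   | new refl d = subst (x <_) (sym e) (<-trans (n<1+n x) (filled s (subst (_≤ c') (sym fr)
              (≤∧≢⇒< (subst (_≤ c') d p) (λ c≡c' → ¬q (refl , sym c≡c'))))))
    ...   | old _ d = subst (x <_) (sym e) (<-trans (n<1+n x) (filled s (subst (_≤ c') d p)))

    blank′ : ∀ {r' c'} → c' < front′ r' → val′ r' c' ≡ 0
    blank′ {r'} {c'} p with cell r' c'
    ... | old ¬q e = trans e (blank s (<-≤-trans p (front′≤ r')))
    ... | new q refl e with row r'
    ...   | new _ d = contradiction p (<-irrefl (sym d))
    ...   | old ne d = contradiction q ne

    mono′ : ∀ {r' c'} → front′ r' ≤ c' → c' < n → val′ r' c' < val′ r' (suc c')
    mono′ {r'} {c'} p c'<n with cell r' c' | cell r' (suc c')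
    ... | new refl refl e | new _ d _ = contradiction (sym d) (<⇒≢ ≤-refl)
    ... | new refl refl e | old _ d = subst₂ _<_ (sym e) (sym d) (filled s (≤-reflexive fr))
    ... | old ¬q e | new refl refl d with row r'
    ...   | new _ f = contradiction (subst (_≤ c') f p) (≤⇒≯ ≤-refl)
    ...   | old ne _ = contradiction refl ne
    mono′ {r'} {c'} p c'<n | old ¬q e | old _ d with row r'
    ...   | new refl f = subst₂ _<_ (sym e) (sym d) (mono s (subst (_≤ c') (sym fr)
              (≤∧≢⇒< (subst (_≤ c') f p) (λ c≡c' → ¬q (refl , sym c≡c')))) c'<n)
    ...   | old _ f = subst₂ _<_ (sym e) (sym d) (mono s (subst (_≤ c') f p) c'<n)

    -- Cells of `s` are 0 or exceed `suc x`, so the inserted value is fresh.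
    not-suc : ∀ {r' c'} → val s r' c' ≢ suc x
    not-suc {r'} {c'} e with blank-or-filled s r' c'
    ... | inj₁ (_ , z) = contradiction (trans (sym z) e) λ ()
    ... | inj₂ (_ , l) = <-irrefl (sym e) l

    inj′ : ∀ {r₁ c₁ r₂ c₂} → c₁ < n → c₂ < n → x < val′ r₁ c₁ → val′ r₁ c₁ ≡ val′ r₂ c₂ → r₁ ≡ r₂ × c₁ ≡ c₂
    inj′ {r₁} {c₁} {r₂} {c₂} l₁ l₂ p q with cell r₁ c₁ | cell r₂ c₂
    ... | new a b _ | new a' b' _ = trans a (sym a') , trans b (sym b')
    ... | new _ _ e | old _ d = contradiction (trans (sym d) (trans (sym q) e)) not-suc
    ... | old _ e | new _ _ d = contradiction (trans (sym e) (trans q d)) not-suc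
    ... | old _ e | old _ d = inj s l₁ l₂ (≤∧≢⇒< (subst (x <_) e p) (λ z → not-suc (sym z)))
                                (trans (sym e) (trans q d))

    surj′ : ∀ {v} → x < v → v ≤ m * n → ∃ λ r' → ∃ λ c' → c' < n × val′ r' c' ≡ v
    surj′ {v} x<v v≤ with m≤n⇒m<n∨m≡n x<v
    ... | inj₂ refl with cell r c
    ...   | new _ _ e = r , c , c<n , e
    ...   | old ¬q _ = contradiction (refl , refl) ¬q
    surj′ {v} x<v v≤ | inj₁ l with surj s l v≤
    -- A value above `suc x` cannot come from the overwritten cell, which held 0.
    ...   | r' , c' , c'<n , e = r' , c' , c'<n , trans (val′-old λ { (refl , refl) →
              contradiction (trans (sym was-blank) e) (λ { refl → contradiction l λ () }) }) e

    push : Stage x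
    push = record
      { val = val′
      ; front = front′
      ; front≤n = λ r' → ≤-trans (front′≤ r') (front≤n s r')
      ; blank = blank′
      ; filled = filled′
      ; sentinel = λ p → trans (val′-old (λ { (_ , refl) → ≤⇒≯ p c<n })) (sentinel s p)
      ; bounded = bounded′
      ; mono = mono′
      ; inj = inj′
      ; surj = surj′
      ; total = suc-injective (trans (+-comm 1 _) (trans (sym (trans (sum-cong-≗ front-split)
                  (trans (∑-distrib-+ front′ _) (cong (sum front′ +_) (sum-𝟙-≟ r))))) (total s)))
      }
      where
      bounded′ : ∀ {r' c'} → c' < n → val′ r' c' ≤ m * n
      bounded′ {r'} {c'} l with cell r' c'
      ... | new _ _ e = subst (_≤ m * n) (sym e) (x≤mn s)
      ... | old _ e = subst (_≤ m * n) (sym e) (bounded s l)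

    push-≈ : val s ≈[ suc x ] val push
    push-≈ r' c' with cell r' c'
    ... | new refl refl e = inj₂ (subst (_≤ suc x) (sym was-blank) z≤n , ≤-reflexive e)
    ... | old _ e = inj₁ (sym e)

    -- Agreement improves from `suc x` to `x`: any other blank cell of `s` holds at most `suc x` in
    -- `t`, and injectivity of `t` excludes `suc x` itself.
    push-≈-final : (t : Stage 0) → val s ≈[ suc x ] val t → val t r c ≡ suc x → val push ≈[ x ] val t
    push-≈-final t s≈t v r' c' with cell r' c' | s≈t r' c'
    ... | new refl refl e | _ = inj₁ (trans e (sym v))
    ... | old _ e | inj₁ q = inj₁ (trans e q)
    ... | old ¬p e | inj₂ (a , b) with blank-or-filled s r' c'
    ...   | inj₂ (_ , l) = contradiction l (≤⇒≯ a)
    ...   | inj₁ (l , z) = inj₂ (subst (_≤ x) (sym (trans e z)) z≤n ,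
              s≤s⁻¹ (≤∧≢⇒< b λ d → ¬p
                (inj t (<-≤-trans l (front≤n s r')) c<n (subst (0 <_) (sym d) z<s) (trans d (sym v)))))

-- Words of ranks: uniqueness and existence of the array.

sum-below : (ℕ → ℕ) → ℕ → ℕ
sum-below k zero    = 0
sum-below k (suc x) = sum-below k x + k x

module Words (m n : ℕ) where
  open Growth m n
  open Stage

  -- Entries start at 1 and letters at position 0, hence `pred`.
  HasCosts : Stage 0 → (ℕ → ℕ) → Set
  HasCosts t k = ∀ {r c} → c < n → cost (val t) r c ≡ k (pred (val t r c))

  HasCostsUpTo : ℕ → Stage 0 → (ℕ → ℕ) → Set
  HasCostsUpTo x t k = ∀ {r c} → c < n → val t r c ≤ x → cost (val t) r c ≡ k (pred (val t r c))

  initial : Stage (m * n)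
  initial = record
    { val = λ r c → if does (c <? n) then 0 else suc (m * n + toℕ r)
    ; front = λ _ → n
    ; front≤n = λ _ → ≤-refl
    ; blank = blank₀
    ; filled = λ {r} n≤c → subst (m * n <_) (sym (sentinel₀ n≤c)) (s≤s (m≤m+n (m * n) (toℕ r)))
    ; sentinel = sentinel₀
    ; bounded = λ l → subst (_≤ m * n) (sym (blank₀ l)) z≤n
    ; mono = λ n≤c c<n → contradiction c<n (≤⇒≯ n≤c)
    ; inj = λ l _ p _ → contradiction (subst (m * n <_) (blank₀ l) p) λ ()
    ; surj = λ p q → contradiction p (≤⇒≯ q)
    ; total = sum-const m n
    }
    where
    blank₀ : ∀ {r : Fin m} {c} → c < n → (if does (c <? n) then 0 else suc (m * n + toℕ r)) ≡ 0
    blank₀ {r} {c} l = cong (λ b → if b then 0 else suc (m * n + toℕ r)) (dec-true (c <? n) l)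
    sentinel₀ : ∀ {r : Fin m} {c} → n ≤ c → (if does (c <? n) then 0 else suc (m * n + toℕ r)) ≡ suc (m * n + toℕ r)
    sentinel₀ {r} {c} n≤c = cong (λ b → if b then 0 else suc (m * n + toℕ r)) (dec-false (c <? n) (≤⇒≯ n≤c))

  initial-≈ : (t : Stage 0) → val initial ≈[ m * n ] val t
  initial-≈ t r c with c <? n
  ... | yes l = inj₂ (subst (_≤ m * n) (sym (blank initial {r} l)) z≤n , bounded t l)
  ... | no ¬l = inj₁ (trans (sentinel initial (≮⇒≥ ¬l)) (sym (sentinel t (≮⇒≥ ¬l))))

  -- Both completions are rebuilt in step. Their entries `suc x` have the same cost, a letter of
  -- `k`, so `cost≡rank` and injectivity of the rank force the same row, and `front-new` the same
  -- column. One push then serves both.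
  common-stage : ∀ {k t t'} → HasCosts t k → HasCosts t' k → ∀ x (s : Stage x) →
    val s ≈[ x ] val t → val s ≈[ x ] val t' →
    Σ (Stage 0) λ s₀ → val s₀ ≈[ 0 ] val t × val s₀ ≈[ 0 ] val t'
  common-stage h h' zero s p p' = s , p , p'
  common-stage {k} {t} {t'} h h' (suc x) s p p'
    with surj t {suc x} z<s (x≤mn s) | surj t' {suc x} z<s (x≤mn s)
  ... | r , c , c<n , v | r' , c' , c'<n , v'
    with rank-injective s {r} {r'} (trans (sym (cost≡rank s t p c<n v)) (trans (trans (h c<n) (cong (k ∘ pred) (trans v (sym v'))))
           (trans (sym (h' c'<n)) (cost≡rank s t' p' c'<n v'))))
  ... | refl with suc-injective (trans (sym (front-new s t p c<n v)) (front-new s t' p' c'<n v'))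
  ...   | refl = common-stage {k} {t} {t'} h h' x push (push-≈-final t p v) (push-≈-final t' p' v')
    where open Push s r c (front-new s t p c<n v)

  costs-determine : ∀ {k t t'} → HasCosts t k → HasCosts t' k → ∀ r c → val t r c ≡ val t' r c
  costs-determine {k} {t} {t'} h h' r c =
    let s₀ , p , p' = common-stage {k} {t} {t'} h h' _ initial (initial-≈ t) (initial-≈ t')
    in trans (sym (exact {val s₀} {val t} p)) (exact {val s₀} {val t'} p')
    where
    exact : ∀ {e e' : Array} → e ≈[ 0 ] e' → e r c ≡ e' r c
    exact p with p r c
    ... | inj₁ q = q
    ... | inj₂ (a , b) = trans (n≤0⇒n≡0 a) (sym (n≤0⇒n≡0 b))

  -- The number of non-full rows is at least min (q + 1) x.  Rank 0 always goes to a row with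
  -- fewest entries, so it can complete a row only when every non-full row lacks a single entry.
  Roomy : ∀ {x} → ℕ → Stage x → Set
  Roomy {x} q s = q < active s ⊎ x ≤ active s

  module _ {x : ℕ} (s : Stage (suc x)) (r : Fin m) (c : ℕ) (fr : front s r ≡ suc c) where
    open Push s r c fr

    active-push : active s ≤ suc (active push)
    active-push = subst (active s ≤_)
      (trans (∑-distrib-+ (λ r' → 𝟙 (0 <? front′ r')) _) (trans (cong (active push +_) (sum-𝟙-≟ r)) (+-comm _ 1)))
      (sum-mono-≤ pointwise)
      where
      pointwise : ∀ r' → 𝟙 (0 <? front s r') ≤ 𝟙 (0 <? front′ r') + 𝟙 (r' ≟ r)
      pointwise r' with row r'
      ... | new p _ = ≤-trans (𝟙-mono (0 <? front s r') (r' ≟ r) (λ _ → p)) (m≤n+m _ _)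
      ... | old _ e = ≤-trans (≤-reflexive (cong (λ f → 𝟙 (0 <? f)) (sym e))) (m≤m+n _ _)

    active-push-0<c : 0 < c → active s ≤ active push
    active-push-0<c 0<c = sum-mono-≤ λ r' → 𝟙-mono (0 <? front s r') (0 <? front′ r') (pointwise r')
      where
      pointwise : ∀ r' → 0 < front s r' → 0 < front′ r'
      pointwise r' l with row r'
      ... | new _ e = subst (0 <_) (sym e) 0<c
      ... | old _ e = subst (0 <_) (sym e) l

    -- Rank 0 means that no row has more blanks than `r`, which has one. So every row has at most
    -- one blank, and the `suc x` blanks lie in distinct rows.
    all-single : c ≡ 0 → rank s r ≡ 0 → suc x ≤ active s
    all-single refl rank≡0 = subst (_≤ active s) (total s) (sum-mono-≤ λ r' → bound r' (≮⇒≥ (λ l →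
        contradiction (≤sum (λ r″ → 𝟙 (_≺?_ s r″ r)) r')
          (<⇒≱ (subst₂ _<_ (sym rank≡0) (sym (𝟙-yes (_≺?_ s r' r) (inj₁ (subst (_< front s r') (sym fr) l)))) z<s)))))
      where
      bound : ∀ r' → front s r' ≤ 1 → front s r' ≤ 𝟙 (0 <? front s r')
      bound r' l with front s r'
      ... | zero = z≤n
      ... | suc zero = ≤-refl
      ... | suc (suc _) = l

    -- `q` is a budget for the remaining letters. A positive letter lowers it by at least one, which
    -- pays for the one row that may become full. A letter 0 pays nothing: either row `r` stays
    -- non-full, or it becomes full and `all-single` gives the second alternative.
    roomy-push : ∀ {q} k → rank s r ≡ k → k ≤ q → Roomy q s → Roomy (q ∸ k) push
    roomy-push k rk k≤q (inj₂ l) = inj₂ (s≤s⁻¹ (≤-trans l active-push))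
    roomy-push {suc q} (suc k) rk k≤q (inj₁ l) = inj₁ (s≤s⁻¹ (≤-trans (s≤s (s≤s (m∸n≤m q k))) (≤-trans l active-push)))
    roomy-push zero rk k≤q (inj₁ l) with c ≟ℕ 0
    ... | yes e = inj₂ (s≤s⁻¹ (≤-trans (all-single e rk) active-push))
    ... | no ne = inj₁ (≤-trans l (active-push-0<c (n≢0⇒n>0 ne)))

    module _ (k : ℕ → ℕ) (rank≡k : rank s r ≡ k x) (t : Stage 0) (p : val push ≈[ x ] val t)
             (costs : HasCostsUpTo x t k) where

      push-≈-trans : val s ≈[ suc x ] val t
      push-≈-trans = ≈-trans {e' = val push} push-≈ p

      new-value : val t r c ≡ suc x
      new-value with cell r c
      ... | new _ _ e = trans (sym (≈-above p (≤-reflexive (sym e)))) e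
      ... | old ¬p _ = contradiction (refl , refl) ¬p

      -- Smaller entries are covered by `costs`; the entry `suc x` costs the rank of its row at
      -- insertion, which was chosen to be `k x`.
      costs-push : HasCostsUpTo (suc x) t k
      costs-push {r'} {c'} l v≤ with m≤n⇒m<n∨m≡n v≤
      ... | inj₁ v< = costs l (s≤s⁻¹ v<)
      ... | inj₂ e with inj t l c<n (subst (0 <_) (sym e) z<s) (trans e (sym new-value))
      ...   | refl , refl = trans (cost≡rank s t push-≈-trans l e) (trans rank≡k (cong (k ∘ pred) (sym e)))

  -- The bound of a letter by its position enters here: in the second alternative `k ≤ x` and
  -- `suc x ≤ active s`.
  roomy⇒active : ∀ {x} {s : Stage (suc x)} {q k} → k ≤ q → k ≤ x → Roomy q s → k < active s
  roomy⇒active k≤q k≤x (inj₁ l) = ≤-<-trans k≤q l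
  roomy⇒active k≤q k≤x (inj₂ l) = <-≤-trans (s≤s k≤x) l

  -- The word dictates the row: `pick` finds the one of rank `k x`, which `Roomy` guarantees to be
  -- non-full, and the recursion continues with the budget lowered by `k x`.
  complete : ∀ (k : ℕ → ℕ) x (s : Stage x) q → sum-below k x ≤ q → (∀ i → i < x → k i ≤ i) → Roomy q s →
    Σ (Stage 0) λ t → val s ≈[ x ] val t × HasCostsUpTo x t k
  -- No blanks remain, so every entry is positive and the cost condition is vacuous.
  complete k zero s q _ _ _ = s , (λ _ _ → inj₁ refl) ,
    λ {r} l v≤0 → contradiction (filled s (subst (_≤ _) (sym (front≡0 s r)) z≤n)) (≤⇒≯ v≤0)
  complete k (suc x) s q sum≤q k≤ roomy =
    let kx≤q = ≤-trans (m≤n+m (k x) (sum-below k x)) sum≤q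
        r , c , fr , rk = pick s (roomy⇒active {s = s} kx≤q (k≤ x ≤-refl) roomy)
        t , p , h = complete k x (Push.push s r c fr) (q ∸ k x)
          (subst (_≤ q ∸ k x) (m+n∸n≡m (sum-below k x) (k x)) (∸-monoˡ-≤ (k x) sum≤q))
          (λ i i<x → k≤ i (m<n⇒m<1+n i<x))
          (roomy-push s r c fr (k x) rk kx≤q roomy)
    in t , push-≈-trans s r c fr k rk t p h , costs-push s r c fr k rk t p h

  -- For positive `n` all `m` rows of the blank array are non-full, so a budget below `m` meets the
  -- first alternative of `Roomy`.
  realise : ∀ k q → sum-below k (m * n) ≤ q → (∀ i → i < m * n → k i ≤ i) → 1 ≤ n → q < m →
    Σ (Stage 0) λ t → HasCosts t k
  realise k q sum≤q k≤ 1≤n q<m =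
    let t , _ , h = complete k (m * n) initial q sum≤q k≤ (inj₁ (subst (q <_) (sym active-initial) q<m))
    in t , λ l → h l (bounded t l)
    where
    active-initial : active initial ≡ m
    active-initial = trans (sum-cong-≗ {m} (λ _ → 𝟙-yes (0 <? n) 1≤n)) (sum-one m)

-- Words as vectors, and list sums.

lookup-ext : ∀ {A : Set} {n} {u v : Vec A n} → (∀ i → lookup u i ≡ lookup v i) → u ≡ v
lookup-ext {u = u} {v} p = trans (sym (tabulate∘lookup u)) (trans (tabulate-cong p) (tabulate∘lookup v))

-- The default 0 only makes the function total; the positions consulted lie below the length.
at : ∀ {n} → Vec ℕ n → ℕ → ℕ
at []      _       = 0
at (a ∷ _) zero    = a
at (_ ∷ w) (suc i) = at w i

at-toℕ : ∀ {n} (w : Vec ℕ n) i → at w (toℕ i) ≡ lookup w i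
at-toℕ (_ ∷ _) F.zero    = refl
at-toℕ (_ ∷ w) (F.suc i) = at-toℕ w i

sum-below-suc : ∀ k x → sum-below k (suc x) ≡ k 0 + sum-below (k ∘ suc) x
sum-below-suc k zero    = sym (+-identityʳ (k 0))
sum-below-suc k (suc x) = trans (cong (_+ k (suc x)) (sum-below-suc k x)) (+-assoc (k 0) _ _)

sum-below-at : ∀ {n} (w : Vec ℕ n) → sum-below (at w) n ≡ sum (lookup w)
sum-below-at [] = refl
sum-below-at {suc n} (a ∷ w) = trans (sum-below-suc (at (a ∷ w)) n) (cong (a +_) (sum-below-at w))

listSum≡sum : ∀ {n} (f : Fin n → ℕ) → ListAction.sum (List.map f (List.allFin n)) ≡ sum f
listSum≡sum f = trans (cong ListAction.sum (List.map-tabulate (λ i → i) f)) (go f)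
  where
  go : ∀ {n} (f : Fin n → ℕ) → ListAction.sum (List.tabulate f) ≡ sum f
  go {zero}  f = refl
  go {suc n} f = cong (f F.zero +_) (go (f ∘ F.suc))

𝟙-⌊⌋ : {A B : Set} (a? : Dec A) (b? : Dec B) → (A → B) → (B → A) → (if ⌊ a? ⌋ then 1 else 0) ≡ 𝟙 b?
𝟙-⌊⌋ (yes a) b? f g = sym (𝟙-yes b? (f a))
𝟙-⌊⌋ (no ¬a) b? f g = sym (𝟙-no b? (¬a ∘ g))

𝟙-split : {A B C : Set} (a? : Dec A) (b? : Dec B) (c? : Dec C) → (A → (B × ¬ C) ⊎ (¬ B × C)) →
  𝟙 (a? ×-dec b?) + 𝟙 (a? ×-dec c?) ≡ 𝟙 a?
𝟙-split (no _)  b? c? f = refl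
𝟙-split (yes a) b? c? f with f a
... | inj₁ (b , ¬c) = cong₂ _+_ (𝟙-yes b? b) (𝟙-no c? ¬c)
... | inj₂ (¬b , c) = cong₂ _+_ (𝟙-no b? ¬b) (𝟙-yes c? c)

-- Translation between tableaux and completed stages.

module _ {m n : ℕ} where
  open Growth m n
  open Words m n
  open Stage

  -- Entries are shifted to start at 1, leaving 0 for blanks; from column `n` on stand the
  -- sentinels.
  extend : Tableau m n → Array
  extend t r c with c <? n
  ... | yes l = suc (toℕ (entry t r (fromℕ< l)))
  ... | no _  = suc (m * n + toℕ r)

  extend-< : ∀ t {r c} (l : c < n) → extend t r c ≡ suc (toℕ (entry t r (fromℕ< l)))
  extend-< t {r} {c} l with c <? n
  ... | yes _ = refl
  ... | no ¬l = contradiction l ¬l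

  extend-≥ : ∀ t {r c} → n ≤ c → extend t r c ≡ suc (m * n + toℕ r)
  extend-≥ t {r} {c} n≤c with c <? n
  ... | yes l = contradiction l (≤⇒≯ n≤c)
  ... | no _  = refl

  extend-toℕ : ∀ t r c → extend t r (toℕ c) ≡ suc (toℕ (entry t r c))
  extend-toℕ t r c = trans (extend-< t (toℕ<n c)) (cong (suc ∘ toℕ ∘ entry t r) (fromℕ<-toℕ c (toℕ<n c)))

  extend-positive : ∀ t r c → 0 < extend t r c
  extend-positive t r c with c <? n
  ... | yes _ = z<s
  ... | no _  = z<s

  toStage : ∀ {t} → RowStandard t → Stage 0
  toStage {t} ((onto , one-one) , increasing) = record
    { val = extend t
    ; front = λ _ → 0
    ; front≤n = λ _ → z≤n
    ; blank = λ ()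
    ; filled = λ {r} {c} _ → extend-positive t r c
    ; sentinel = extend-≥ t
    ; bounded = bounded′
    ; mono = λ {r} {c} _ l → mono′ r c l
    ; inj = inj′
    ; surj = surj′
    ; total = sum-zero m
    }
    where
    bounded′ : ∀ {r c} → c < n → extend t r c ≤ m * n
    bounded′ l = subst (_≤ m * n) (sym (extend-< t l)) (toℕ<n _)
    mono′ : ∀ r c → c < n → extend t r c < extend t r (suc c)
    mono′ r c l with suc c <? n
    ... | yes l' = subst (_< suc (toℕ (entry t r (fromℕ< l')))) (sym (extend-< t l))
                     (s<s (increasing r _ _ (subst₂ _<_ (sym (toℕ-fromℕ< l)) (sym (toℕ-fromℕ< l')) ≤-refl)))
    -- In the last column the right neighbour is the sentinel, which exceeds every entry.
    ... | no _ = s≤s (≤-trans (bounded′ l) (m≤m+n (m * n) (toℕ r)))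
    inj′ : ∀ {r c r' c'} → c < n → c' < n → 0 < extend t r c → extend t r c ≡ extend t r' c' → r ≡ r' × c ≡ c'
    inj′ l l' _ e with one-one _ _ _ _ (toℕ-injective (suc-injective (trans (sym (extend-< t l)) (trans e (extend-< t l')))))
    ... | p , q = p , trans (sym (toℕ-fromℕ< l)) (trans (cong toℕ q) (toℕ-fromℕ< l'))
    surj′ : ∀ {v} → 0 < v → v ≤ m * n → ∃ λ r → ∃ λ c → c < n × extend t r c ≡ v
    surj′ {suc v} _ v< with onto (fromℕ< v<)
    ... | r , c , e = r , toℕ c , toℕ<n c ,
          trans (extend-toℕ t r c) (cong suc (trans (cong toℕ e) (toℕ-fromℕ< v<)))

  module FromStage (s : Stage 0) where
    front≤ : ∀ r c → front s r ≤ c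
    front≤ r c = subst (_≤ c) (sym (front≡0 s r)) z≤n

    value : ∀ r c → suc (pred (val s r c)) ≡ val s r c
    value r c = suc-pred (val s r c) ⦃ >-nonZero (filled s (front≤ r c)) ⦄

    value< : ∀ r (c : Fin n) → pred (val s r (toℕ c)) < m * n
    value< r c = subst (_≤ m * n) (sym (value r (toℕ c))) (bounded s (toℕ<n c))

    fromStage : Tableau m n
    fromStage = tabulate λ r → tabulate λ c → fromℕ< (value< r c)

    entry≡ : ∀ r c → suc (toℕ (entry fromStage r c)) ≡ val s r (toℕ c)
    entry≡ r c = trans (cong (suc ∘ toℕ) (trans
      (cong (λ row → lookup row c) (lookup∘tabulate _ r)) (lookup∘tabulate _ c)))
      (trans (cong suc (toℕ-fromℕ< (value< r c))) (value r (toℕ c)))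

    fromStage-rowStandard : RowStandard fromStage
    fromStage-rowStandard = (onto , one-one) , increasing
      where
      onto : ∀ k → ∃[ r ] ∃[ c ] entry fromStage r c ≡ k
      onto k with surj s {suc (toℕ k)} z<s (toℕ<n k)
      ... | r , c , l , e = r , fromℕ< l , toℕ-injective (suc-injective
            (trans (entry≡ r (fromℕ< l)) (trans (cong (val s r) (toℕ-fromℕ< l)) e)))
      one-one : ∀ r c r' c' → entry fromStage r c ≡ entry fromStage r' c' → (r ≡ r') × (c ≡ c')
      one-one r c r' c' e with inj s (toℕ<n c) (toℕ<n c') (filled s (front≤ r (toℕ c)))
        (trans (sym (entry≡ r c)) (trans (cong (suc ∘ toℕ) e) (entry≡ r' c')))
      ... | p , q = p , toℕ-injective q
      along : ∀ r {c c'} → c < c' → c' < n → val s r c < val s r c'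
      along r {c} {suc c'} l l' with m<1+n⇒m<n∨m≡n l
      ... | inj₂ refl = mono s (front≤ r c) (<⇒≤ l')
      ... | inj₁ c<c' = <-trans (along r c<c' (<⇒≤ l')) (mono s (front≤ r c') (<⇒≤ l'))
      increasing : ∀ r c c' → c F.< c' → entry fromStage r c F.< entry fromStage r c'
      increasing r c c' l = s<s⁻¹ (subst₂ _<_ (sym (entry≡ r c)) (sym (entry≡ r c')) (along r l (toℕ<n c')))

    extend-fromStage : ∀ r c → extend fromStage r c ≡ val s r c
    extend-fromStage r c with c <? n
    ... | yes l = trans (entry≡ r (fromℕ< l)) (cong (val s r) (toℕ-fromℕ< l))
    ... | no ¬l = sym (sentinel s (≮⇒≥ ¬l))

  -- The word of a tableau.

  cost-cong : ∀ {e e' : Array} → (∀ r c → e r c ≡ e' r c) → ∀ r c → cost e r c ≡ cost e' r c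
  cost-cong {e} {e'} p r c = sum-cong-≗ λ r' →
    𝟙-cong ((e r' c <? e r c) ×-dec (e r' (suc c) <? e r (suc c)))
           ((e' r' c <? e' r c) ×-dec (e' r' (suc c) <? e' r (suc c)))
      (map (subst₂ _<_ (p r' c) (p r c)) (subst₂ _<_ (p r' (suc c)) (p r (suc c))))
      (map (subst₂ _<_ (sym (p r' c)) (sym (p r c))) (subst₂ _<_ (sym (p r' (suc c))) (sym (p r (suc c)))))

  -- Summing over all cells instead of locating `v` makes sense for every filling; in a bijective
  -- one only the cell of `v` can contribute.
  word : Tableau m n → Vec ℕ (m * n)
  word t = tabulate λ v → sum {m} λ r → sum {n} λ c →
    if does (v ≟ entry t r c) then cost (extend t) r (toℕ c) else 0

  lookup-word-entry : ∀ {t} → RowStandard t → ∀ r c → lookup (word t) (entry t r c) ≡ cost (extend t) r (toℕ c)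
  lookup-word-entry {t} ((_ , one-one) , _) r c = trans (lookup∘tabulate _ (entry t r c))
    (trans (sum-single _ r λ r' r'≢r → trans (sum-cong-≗ λ c' → other r' c' (λ { refl → r'≢r refl })) (sum-zero n))
    (trans (sum-single _ c λ c' c'≢c → other r c' (λ { refl → c'≢c refl }))
           (cong (λ b → if b then cost (extend t) r (toℕ c) else 0) (dec-true (entry t r c ≟ entry t r c) refl))))
    where
    other : ∀ r' c' → (r' , c') ≢ (r , c) →
      (if does (entry t r c ≟ entry t r' c') then cost (extend t) r' (toℕ c') else 0) ≡ 0
    other r' c' ne = cong (λ b → if b then cost (extend t) r' (toℕ c') else 0)
      (dec-false (entry t r c ≟ entry t r' c') λ e →
        let p , q = one-one r c r' c' e in ne (cong₂ _,_ (sym p) (sym q)))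

  word-costs : ∀ {t} (rs : RowStandard t) → HasCosts (toStage rs) (at (word t))
  word-costs {t} rs {r} {c} l = begin
    cost (extend t) r c                              ≡⟨ cong (cost (extend t) r) (sym (toℕ-fromℕ< l)) ⟩
    cost (extend t) r (toℕ (fromℕ< l))               ≡⟨ sym (lookup-word-entry rs r (fromℕ< l)) ⟩
    lookup (word t) (entry t r (fromℕ< l))           ≡⟨ sym (at-toℕ (word t) _) ⟩
    at (word t) (toℕ (entry t r (fromℕ< l)))         ≡⟨ cong (at (word t) ∘ pred) (sym (extend-< t l)) ⟩
    at (word t) (pred (extend t r c))                ∎
    where open ≡-Reasoning

  word-injective : ∀ {t t'} → RowStandard t → RowStandard t' → word t ≡ word t' → t ≡ t'
  word-injective {t} {t'} rs rs' e = lookup-ext λ r → lookup-ext λ c → toℕ-injective (suc-injective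
    (trans (sym (extend-toℕ t r c)) (trans
      (costs-determine {at (word t)} {toStage rs} {toStage rs'} (word-costs rs)
        (subst (λ w → HasCosts (toStage rs') (at w)) (sym e) (word-costs rs')) r (toℕ c))
      (extend-toℕ t' r c))))

  -- The cost counts rows with a smaller entry in the same column. These entries are distinct, so
  -- `count-below` applies.
  word-bounded : ∀ {t} → RowStandard t → ∀ v → lookup (word t) v ≤ toℕ v
  word-bounded {t} rs@((onto , one-one) , _) v with onto v
  ... | r , c , refl = begin
    lookup (word t) (entry t r c)                                       ≡⟨ lookup-word-entry rs r c ⟩
    cost (extend t) r (toℕ c)                                           ≤⟨ sum-mono-≤ (λ r' → 𝟙-mono
        ((extend t r' (toℕ c) <? extend t r (toℕ c)) ×-dec (extend t r' (suc (toℕ c)) <? extend t r (suc (toℕ c))))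
        (toℕ (entry t r' c) <? toℕ (entry t r c))
        (λ p → s<s⁻¹ (subst₂ _<_ (extend-toℕ t r' c) (extend-toℕ t r c) (proj₁ p)))) ⟩
    sum {m} (λ r' → 𝟙 (toℕ (entry t r' c) <? toℕ (entry t r c)))        ≤⟨ count-below
        (λ {r₁} {r₂} e → proj₁ (one-one r₁ c r₂ c (toℕ-injective e))) (toℕ (entry t r c)) ⟩
    toℕ (entry t r c)                                                   ∎
    where open ≤-Reasoning

  word-surjective : ∀ w → 1 ≤ n → (∀ v → lookup w v ≤ toℕ v) → sum (lookup w) < m →
    ∃ λ t → RowStandard t × word t ≡ w
  word-surjective w 1≤n w≤ w<m = fromStage , rs , lookup-ext same
    where
    at≤ : ∀ i → i < m * n → at w i ≤ i
    at≤ i l = subst (λ j → at w j ≤ j) (toℕ-fromℕ< l) (subst (_≤ toℕ (fromℕ< l)) (sym (at-toℕ w (fromℕ< l))) (w≤ (fromℕ< l)))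
    realisation : Σ (Stage 0) λ s → HasCosts s (at w)
    realisation = realise (at w) (sum (lookup w)) (≤-reflexive (sum-below-at w)) at≤ 1≤n w<m
    s : Stage 0
    s = proj₁ realisation
    open FromStage s
    rs = fromStage-rowStandard
    open ≡-Reasoning
    same : ∀ v → lookup (word fromStage) v ≡ lookup w v
    same v with proj₁ (proj₁ rs) v
    ... | r , c , refl = begin
      lookup (word fromStage) (entry fromStage r c) ≡⟨ lookup-word-entry rs r c ⟩
      cost (extend fromStage) r (toℕ c)             ≡⟨ cost-cong extend-fromStage r (toℕ c) ⟩
      cost (val s) r (toℕ c)                        ≡⟨ proj₂ realisation (toℕ<n c) ⟩
      at w (pred (val s r (toℕ c)))                 ≡⟨ cong (at w ∘ pred) (sym (entry≡ r c)) ⟩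
      at w (toℕ (entry fromStage r c))              ≡⟨ at-toℕ w _ ⟩
      lookup w (entry fromStage r c)                ∎

  -- Inversions and the sum of the word.

  isInversion-count : ∀ t (c : Fin n) r r' → (if isInversion t c r r' then 1 else 0) ≡
    𝟙 ((extend t r (toℕ c) <? extend t r' (toℕ c)) ×-dec (extend t r' (suc (toℕ c)) <? extend t r (suc (toℕ c))))
  isInversion-count t c r r' with entry t r c <ᶠ? entry t r' c
  ... | no ¬p = sym (𝟙-no ((extend t r (toℕ c) <? extend t r' (toℕ c)) ×-dec (extend t r' (suc (toℕ c)) <? extend t r (suc (toℕ c))))
                  (λ q → ¬p (s<s⁻¹ (subst₂ _<_ (extend-toℕ t r c) (extend-toℕ t r' c) (proj₁ q)))))
  ... | yes p with suc (toℕ c) <? n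
  ...   | yes l = 𝟙-⌊⌋ (entry t r' (fromℕ< l) <ᶠ? entry t r (fromℕ< l))
                    ((extend t r (toℕ c) <? extend t r' (toℕ c)) ×-dec (suc (toℕ (entry t r' (fromℕ< l))) <? suc (toℕ (entry t r (fromℕ< l)))))
                    (λ q → subst₂ _<_ (sym (extend-toℕ t r c)) (sym (extend-toℕ t r' c)) (s<s p) , s<s q)
                    (s<s⁻¹ ∘ proj₂)
  -- In the last column comparing sentinels means comparing row indices: the smaller entry, in row
  -- `r`, must lie below.
  ...   | no _ = 𝟙-⌊⌋ (r' <ᶠ? r)
                    ((extend t r (toℕ c) <? extend t r' (toℕ c)) ×-dec (suc (m * n + toℕ r') <? suc (m * n + toℕ r)))
                    (λ q → subst₂ _<_ (sym (extend-toℕ t r c)) (sym (extend-toℕ t r' c)) (s<s p) , s<s (+-monoʳ-< (m * n) q))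
                    (+-cancelˡ-< (m * n) _ _ ∘ s<s⁻¹ ∘ proj₂)

  module _ {t : Tableau m n} (rs : RowStandard t) where
    private
      e : Array
      e = extend t

      asc? : ∀ c r r' → Dec (e r c < e r' c × e r (suc c) < e r' (suc c))
      asc? c r r' = (e r c <? e r' c) ×-dec (e r (suc c) <? e r' (suc c))

      desc? : ∀ c r r' → Dec (e r c < e r' c × e r' (suc c) < e r (suc c))
      desc? c r r' = (e r c <? e r' c) ×-dec (e r' (suc c) <? e r (suc c))

    column-injective : ∀ {c} → c ≤ n → Injective _≡_ _≡_ (λ r → e r c)
    column-injective {c} c≤n {r} {r'} q with m≤n⇒m<n∨m≡n c≤n
    ... | inj₁ l = proj₁ (inj (toStage rs) l l (extend-positive t r c) q)
    ... | inj₂ refl = toℕ-injective (+-cancelˡ-≡ (m * n) _ _ (suc-injective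
            (trans (sym (extend-≥ t {r} ≤-refl)) (trans q (extend-≥ t {r'} ≤-refl)))))

    -- Right neighbours in distinct rows differ, also among the sentinels, so a pair ordered in
    -- column `c` is ordered the same or the opposite way in the next column, never tied.
    asc+desc : ∀ {c} → c < n → ∀ r r' → 𝟙 (asc? c r r') + 𝟙 (desc? c r r') ≡ 𝟙 (e r c <? e r' c)
    asc+desc {c} l r r' = 𝟙-split (e r c <? e r' c) (e r (suc c) <? e r' (suc c)) (e r' (suc c) <? e r (suc c)) next
      where
      next : e r c < e r' c → (e r (suc c) < e r' (suc c) × ¬ e r' (suc c) < e r (suc c)) ⊎
                              (¬ e r (suc c) < e r' (suc c) × e r' (suc c) < e r (suc c))
      next p with <-cmp (e r (suc c)) (e r' (suc c))
      ... | tri< q _ ¬q = inj₁ (q , ¬q)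
      ... | tri> ¬q _ q = inj₂ (¬q , q)
      ... | tri≈ _ q _ = contradiction p (<-irrefl (cong (λ i → e i c) (column-injective l q)))

    sum-word : sum (lookup (word t)) ≡ sum {n} (λ c → sum λ r → sum λ r' → 𝟙 (asc? (toℕ c) r r'))
    sum-word = begin
      sum (lookup (word t))
        ≡⟨ sum-cong-≗ (lookup∘tabulate (λ v → sum λ r → sum λ c → summand v r c)) ⟩
      sum {m * n} (λ v → sum {m} λ r → sum {n} λ c → summand v r c)
        ≡⟨ ∑-comm (λ v r → sum {n} λ c → summand v r c) ⟩
      sum {m} (λ r → sum {m * n} λ v → sum {n} λ c → summand v r c)
        ≡⟨ sum-cong-≗ {m} (λ r → ∑-comm (λ v c → summand v r c)) ⟩
      sum {m} (λ r → sum {n} λ c → sum {m * n} λ v → summand v r c)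
        -- With the sum over `v` innermost, only the entry of the cell in row `r` and column `c`
        -- contributes.
        ≡⟨ sum-cong-≗ {m} (λ r → sum-cong-≗ {n} (λ c → trans
             (sum-single (λ v → summand v r c) (entry t r c) (λ v v≢ → hit r c (dec-false (v ≟ entry t r c) v≢)))
             (hit r c (dec-true (entry t r c ≟ entry t r c) refl)))) ⟩
      sum {m} (λ r → sum {n} λ c → cost e r (toℕ c))
        ≡⟨ ∑-comm {m} {n} (λ r c → cost e r (toℕ c)) ⟩
      sum {n} (λ c → sum {m} λ r → cost e r (toℕ c))
        -- `cost` fixes the row of the larger element first; the exchange puts the smaller one
        -- first, as in `inversions`.
        ≡⟨ sum-cong-≗ {n} (λ c → ∑-comm (λ r r' → 𝟙 (asc? (toℕ c) r' r))) ⟩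
      sum {n} (λ c → sum {m} λ r → sum {m} λ r' → 𝟙 (asc? (toℕ c) r r')) ∎
      where
      open ≡-Reasoning
      summand : Fin (m * n) → Fin m → Fin n → ℕ
      summand v r c = if does (v ≟ entry t r c) then cost e r (toℕ c) else 0
      hit : ∀ r c {b b'} → b ≡ b' → (if b then cost e r (toℕ c) else 0) ≡ (if b' then cost e r (toℕ c) else 0)
      hit r c = cong (λ b → if b then cost e r (toℕ c) else 0)

    inversions-sum : inversions t ≡ sum {n} (λ c → sum λ r → sum λ r' → 𝟙 (desc? (toℕ c) r r'))
    inversions-sum = trans (listSum≡sum {n} _) (sum-cong-≗ {n} λ c → trans (listSum≡sum {m} _)
      (sum-cong-≗ {m} λ r → trans (listSum≡sum {m} _) (sum-cong-≗ {m} λ r' → isInversion-count t c r r')))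

    -- In each column the non-inverted and inverted pairs together are all pairs of rows, which
    -- `count-pairs` counts.
    sum-word+inversions : sum (lookup (word t)) + inversions t ≡ n * T (m ∸ 1)
    sum-word+inversions = begin
      sum (lookup (word t)) + inversions t
        ≡⟨ cong₂ _+_ sum-word inversions-sum ⟩
      sum {n} (λ c → sum λ r → sum λ r' → 𝟙 (asc? (toℕ c) r r')) + sum {n} (λ c → sum λ r → sum λ r' → 𝟙 (desc? (toℕ c) r r'))
        ≡⟨ sym (∑-distrib-+ {n} _ _) ⟩
      sum {n} (λ c → sum {m} (λ r → sum {m} λ r' → 𝟙 (asc? (toℕ c) r r')) + sum {m} (λ r → sum {m} λ r' → 𝟙 (desc? (toℕ c) r r')))
        ≡⟨ sum-cong-≗ {n} (λ c → trans (sym (∑-distrib-+ {m} _ _)) (trans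
             (sum-cong-≗ {m} (λ r → trans (sym (∑-distrib-+ {m} _ _)) (sum-cong-≗ {m} (asc+desc (toℕ<n c) r))))
             (count-pairs (column-injective (<⇒≤ (toℕ<n c)))))) ⟩
      sum {n} (λ _ → T (m ∸ 1))
        ≡⟨ sum-const n _ ⟩
      n * T (m ∸ 1) ∎
      where open ≡-Reasoning

-- Weak compositions.

incHead : ∀ {n} → Vec ℕ (suc n) → Vec ℕ (suc n)
incHead (a ∷ w) = suc a ∷ w

incHead-injective : ∀ {n} {u v : Vec ℕ (suc n)} → incHead u ≡ incHead v → u ≡ v
incHead-injective {u = _ ∷ _} {v = _ ∷ _} refl = refl

-- Parts may be 0. Splitting on whether the first part is 0 gives Pascal's recurrence for the
-- length.
compositions : ∀ n → ℕ → List (Vec ℕ n)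
compositions zero    zero    = [ [] ]
compositions zero    (suc q) = []ᴸ
compositions (suc n) zero    = List.map (0 ∷_) (compositions n zero)
compositions (suc n) (suc q) = List.map (0 ∷_) (compositions n (suc q)) ++ List.map incHead (compositions (suc n) q)

compositions-unique : ∀ n q → Unique (compositions n q)
compositions-unique zero    zero    = [] ∷ []
compositions-unique zero    (suc q) = []
compositions-unique (suc n) zero    = Unique.map⁺ ∷-injectiveʳ (compositions-unique n zero)
compositions-unique (suc n) (suc q) = Unique.++⁺
  (Unique.map⁺ ∷-injectiveʳ (compositions-unique n (suc q)))
  (Unique.map⁺ incHead-injective (compositions-unique (suc n) q)) disjoint
  where
  disjoint : ∀ {v} → ¬ (v ∈ List.map (0 ∷_) (compositions n (suc q)) × v ∈ List.map incHead (compositions (suc n) q))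
  disjoint (p , p') with ∈-map⁻ (0 ∷_) p | ∈-map⁻ incHead p'
  ... | _ , _ , refl | (_ ∷ _) , _ , ()

compositions-sound : ∀ n q {w} → w ∈ compositions n q → sum (lookup w) ≡ q
compositions-sound zero    zero    (here refl) = refl
compositions-sound (suc n) zero    p with ∈-map⁻ (0 ∷_) p
... | _ , p' , refl = compositions-sound n zero p'
compositions-sound (suc n) (suc q) p with ∈-++⁻ (List.map (0 ∷_) (compositions n (suc q))) p
... | inj₁ p₁ with ∈-map⁻ (0 ∷_) p₁
...   | _ , p' , refl = compositions-sound n (suc q) p'
compositions-sound (suc n) (suc q) p | inj₂ p₂ with ∈-map⁻ incHead p₂
...   | (_ ∷ _) , p' , refl = cong suc (compositions-sound (suc n) q p')

compositions-complete : ∀ n q (w : Vec ℕ n) → sum (lookup w) ≡ q → w ∈ compositions n q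
compositions-complete zero    _       []            refl = here refl
compositions-complete (suc n) zero    (zero ∷ w)    e = ∈-map⁺ (0 ∷_) (compositions-complete n zero w e)
compositions-complete (suc n) (suc q) (zero ∷ w)    e = ∈-++⁺ˡ (∈-map⁺ (0 ∷_) (compositions-complete n (suc q) w e))
compositions-complete (suc n) (suc q) (suc a ∷ w)   e = ∈-++⁺ʳ (List.map (0 ∷_) (compositions n (suc q)))
  (∈-map⁺ incHead (compositions-complete (suc n) q (a ∷ w) (suc-injective e)))

length-compositions-suc : ∀ n q → length (compositions (suc n) (suc q)) ≡
  length (compositions n (suc q)) + length (compositions (suc n) q)
length-compositions-suc n q = trans (List.length-++ (List.map (0 ∷_) (compositions n (suc q))))
  (cong₂ _+_ (List.length-map (0 ∷_) (compositions n (suc q))) (List.length-map incHead (compositions (suc n) q)))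

length-compositions-0 : ∀ n → length (compositions n 0) ≡ 1
length-compositions-0 zero    = refl
length-compositions-0 (suc n) = trans (List.length-map (0 ∷_) (compositions n 0)) (length-compositions-0 n)

length-compositions-1 : ∀ n → length (compositions n 1) ≡ n
length-compositions-1 zero    = refl
length-compositions-1 (suc n) = trans (length-compositions-suc n 0)
  (trans (cong₂ _+_ (length-compositions-1 n) (length-compositions-0 (suc n))) (+-comm n 1))

-- Doubling keeps the triangular number free of division during the induction.
length-compositions-2 : ∀ n → length (compositions n 2) * 2 ≡ n * suc n
length-compositions-2 zero    = refl
length-compositions-2 (suc n) = begin
  length (compositions (suc n) 2) * 2                    ≡⟨ cong (_* 2) (trans (length-compositions-suc n 1)
                                                              (cong (L +_) (length-compositions-1 (suc n)))) ⟩
  (L + suc n) * 2                                        ≡⟨ *-distribʳ-+ 2 L (suc n) ⟩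
  L * 2 + suc n * 2                                      ≡⟨ cong (_+ suc n * 2) (length-compositions-2 n) ⟩
  n * suc n + suc n * 2                                  ≡⟨ solve 1 (λ n → n :* (con 1 :+ n) :+ (con 1 :+ n) :* con 2
                                                              := (con 1 :+ n) :* (con 2 :+ n)) refl n ⟩
  suc n * suc (suc n)                                    ∎
  where
  open ≡-Reasoning
  open +-*-Solver
  L = length (compositions n 2)

-- Admissible words of sum 2.

Admissible : ∀ {N} → Vec ℕ N → Set
Admissible w = ∀ v → lookup w v ≤ toℕ v

-- A second letter 0 leaves the weak compositions of 2 over the remaining `N ∸ 2` positions, a
-- second letter 1 those of 1. The count is a triangular number plus `N ∸ 2`.
admissible-words : ∀ N → 2 ≤ N → Σ (List (Vec ℕ N)) λ ws →
  Unique ws × (∀ w → w ∈ ws ⇔ (Admissible w × sum (lookup w) ≡ 2)) × length ws ≡ ((N ∸ 2) * (N + 1)) / 2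
admissible-words (suc (suc N)) (s≤s (s≤s z≤n)) = ws₀ ++ ws₁ , Unique.++⁺ unique₀ unique₁ disjoint , (λ w → mk⇔ sound (complete′ w)) , size
  where
  prefix : ℕ → Vec ℕ N → Vec ℕ (suc (suc N))
  prefix b w = 0 ∷ b ∷ w

  ws₀ ws₁ : List (Vec ℕ (suc (suc N)))
  ws₀ = List.map (prefix 0) (compositions N 2)
  ws₁ = List.map (prefix 1) (compositions N 1)

  unique₀ : Unique ws₀
  unique₀ = Unique.map⁺ (λ { refl → refl }) (compositions-unique N 2)

  unique₁ : Unique ws₁
  unique₁ = Unique.map⁺ (λ { refl → refl }) (compositions-unique N 1)

  disjoint : ∀ {v} → ¬ (v ∈ ws₀ × v ∈ ws₁)
  disjoint (p , p') with ∈-map⁻ (prefix 0) p | ∈-map⁻ (prefix 1) p'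
  ... | _ , _ , refl | _ , _ , ()

  admissible : ∀ {b w} → b ≤ 1 → sum (lookup w) ≤ 2 → Admissible (prefix b w)
  admissible b≤1 s≤2 F.zero            = z≤n
  admissible b≤1 s≤2 (F.suc F.zero)    = b≤1
  -- From position 2 on the bound is automatic: a letter is at most the sum, hence at most 2.
  admissible {w = w} b≤1 s≤2 (F.suc (F.suc i)) = ≤-trans (≤sum (lookup w) i) (≤-trans s≤2 (s≤s (s≤s z≤n)))

  sound : ∀ {w} → w ∈ ws₀ ++ ws₁ → Admissible w × sum (lookup w) ≡ 2
  sound p with ∈-++⁻ ws₀ p
  ... | inj₁ p₀ with ∈-map⁻ (prefix 0) p₀
  ...   | w , p' , refl = admissible {0} {w} z≤n (≤-reflexive s) , s
    where s = compositions-sound N 2 p'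
  sound p | inj₂ p₁ with ∈-map⁻ (prefix 1) p₁
  ...   | w , p' , refl = admissible {1} {w} ≤-refl (≤-trans (≤-reflexive s) (n≤1+n 1)) , cong suc s
    where s = compositions-sound N 1 p'

  complete′ : ∀ w → Admissible w × sum (lookup w) ≡ 2 → w ∈ ws₀ ++ ws₁
  complete′ (zero ∷ zero ∷ w) (_ , s) = ∈-++⁺ˡ (∈-map⁺ (prefix 0) (compositions-complete N 2 w s))
  complete′ (zero ∷ suc zero ∷ w) (_ , s) = ∈-++⁺ʳ ws₀ (∈-map⁺ (prefix 1) (compositions-complete N 1 w (suc-injective s)))
  complete′ (zero ∷ suc (suc _) ∷ w) (a , _) = contradiction (a (F.suc F.zero)) λ { (s≤s ()) }
  complete′ (suc _ ∷ _) (a , _) = contradiction (a F.zero) λ ()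

  size : length (ws₀ ++ ws₁) ≡ (N * (suc (suc N) + 1)) / 2
  size = begin
    length (ws₀ ++ ws₁)                      ≡⟨ List.length-++ ws₀ ⟩
    length ws₀ + length ws₁                  ≡⟨ cong₂ _+_ (List.length-map (prefix 0) (compositions N 2))
                                                  (trans (List.length-map (prefix 1) (compositions N 1)) (length-compositions-1 N)) ⟩
    L + N                                    ≡⟨ sym (m*n/n≡m (L + N) 2) ⟩
    (L + N) * 2 / 2                          ≡⟨ cong (_/ 2) (trans (*-distribʳ-+ 2 L N) (trans (cong (_+ N * 2) (length-compositions-2 N))
                                                  (solve 1 (λ N → N :* (con 1 :+ N) :+ N :* con 2 := N :* (con 2 :+ N :+ con 1)) refl N))) ⟩
    (N * (suc (suc N) + 1)) / 2              ∎
    where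
    open ≡-Reasoning
    open +-*-Solver
    L = length (compositions N 2)

-- Transfer of the count from words to tableaux.

preimages : {A B : Set} {P : A → Set} (f : A → B) (ys : List B) → (∀ {y} → y ∈ ys → ∃ λ x → P x × f x ≡ y) →
  Σ (List A) λ xs → List.map f xs ≡ ys × (∀ {x} → x ∈ xs → P x)
preimages f []ᴸ       g = []ᴸ , refl , λ ()
preimages f (y ∷ᴸ ys) g with g (here refl) | preimages f ys (g ∘ there)
... | x , px , refl | xs , refl , pxs = x ∷ᴸ xs , refl , λ { (here refl) → px ; (there p) → pxs p }

-- Makes the truncated subtraction of 2 from the maximum a genuine one: as `m ∸ 1` is at least 2,
-- its triangular number is at least 3.
2≤nT : ∀ {n m} → 1 ≤ n → 3 ≤ m → 2 ≤ n * T (m ∸ 1)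
2≤nT {n} {suc m} 1≤n (s≤s 2≤m) = begin
  2                    ≤⟨ n≤1+n 2 ⟩
  (2 * 3) / 2          ≤⟨ /-monoˡ-≤ 2 (*-mono-≤ 2≤m (s≤s 2≤m)) ⟩
  T m                  ≡⟨ sym (*-identityˡ (T m)) ⟩
  1 * T m              ≤⟨ *-monoˡ-≤ (T m) 1≤n ⟩
  n * T m              ∎
  where open ≤-Reasoning

theorem4p2 : (n m : ℕ) → 1 ≤ n → 3 ≤ m →
    Σ (List (Tableau m n)) (λ S →
    Unique S ×
    (∀ (t : Tableau m n) → (t ∈ S) ⇔ (RowStandard t × (inversions t ≡ n * T (m ∸ 1) ∸ 2))) ×
    (length S ≡ ((m * n ∸ 2) * (m * n + 1)) / 2))
theorem4p2 n m 1≤n 3≤m = pullBack (admissible-words (m * n) (≤-trans (n≤1+n 2) (*-mono-≤ 3≤m 1≤n)))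
  where
  two-noninversions : ∀ {t : Tableau m n} → RowStandard t →
    sum (lookup (word t)) ≡ 2 ⇔ inversions t ≡ n * T (m ∸ 1) ∸ 2
  two-noninversions {t} rs = mk⇔
    (λ s → trans (sym (m+n∸m≡n 2 (inversions t)))
      (cong (_∸ 2) (trans (cong (_+ inversions t) (sym s)) (sum-word+inversions rs))))
    (λ e → +-cancelʳ-≡ (inversions t) _ _
      (trans (sum-word+inversions rs) (sym (trans (cong (2 +_) e) (m+[n∸m]≡n (2≤nT {n} 1≤n 3≤m))))))

  pullBack : (Σ (List (Vec ℕ (m * n))) λ ws → Unique ws ×
      (∀ w → w ∈ ws ⇔ (Admissible w × sum (lookup w) ≡ 2)) × length ws ≡ ((m * n ∸ 2) * (m * n + 1)) / 2) →
    Σ (List (Tableau m n)) λ S → Unique S ×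
      (∀ t → t ∈ S ⇔ (RowStandard t × inversions t ≡ n * T (m ∸ 1) ∸ 2)) × length S ≡ ((m * n ∸ 2) * (m * n + 1)) / 2
  pullBack (ws , unique , spec , size) = assemble (preimages word ws tableau) unique spec size
    where
    tableau : ∀ {w} → w ∈ ws → ∃ λ t → RowStandard t × word t ≡ w
    tableau {w} p =
      let admissible , s = Equivalence.to (spec w) p
      -- The sum of the word is 2, and `3 ≤ m` is exactly `2 < m`.
      in word-surjective w 1≤n admissible (subst (_< m) (sym s) 3≤m)

    assemble : ∀ {ws} → (Σ (List (Tableau m n)) λ S → List.map word S ≡ ws × (∀ {t} → t ∈ S → RowStandard t)) →
      Unique ws → (∀ w → w ∈ ws ⇔ (Admissible w × sum (lookup w) ≡ 2)) →
      length ws ≡ ((m * n ∸ 2) * (m * n + 1)) / 2 →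
      Σ (List (Tableau m n)) λ S → Unique S ×
        (∀ t → t ∈ S ⇔ (RowStandard t × inversions t ≡ n * T (m ∸ 1) ∸ 2)) × length S ≡ ((m * n ∸ 2) * (m * n + 1)) / 2
    -- The list of words is now `List.map word S`, so uniqueness and length carry over to `S`;
    -- injectivity of `word` enters in `exhaustive`.
    assemble (S , refl , rowStandard) unique spec size =
      S , Unique.map⁻ unique , (λ t → mk⇔ (sound t) (exhaustive t)) , trans (sym (List.length-map word S)) size
      where
      sound : ∀ t → t ∈ S → RowStandard t × inversions t ≡ n * T (m ∸ 1) ∸ 2
      sound t p = rowStandard p ,
        Equivalence.to (two-noninversions (rowStandard p)) (proj₂ (Equivalence.to (spec (word t)) (∈-map⁺ word p)))
      exhaustive : ∀ t → RowStandard t × inversions t ≡ n * T (m ∸ 1) ∸ 2 → t ∈ S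
      exhaustive t (rs , e) =
        -- The word of `t` is listed, hence is the word of some `t'` in `S`, and `word-injective`
        -- identifies the two.
        let t' , p , q = ∈-map⁻ word (Equivalence.from (spec (word t))
                           (word-bounded rs , Equivalence.from (two-noninversions rs) e))
        in subst (_∈ S) (sym (word-injective rs (rowStandard p) q)) p
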